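{- Let $n\ge 1$. For every parking function $f\in \mathrm{PF}_n$, $$\mathrm{pmaj}(\phi_n(f))=\mathrm{area}(f).$$
   Context: Let $n\geq 1$ and $[n]=\{1,\dots,n\}$. A parking function of size $n$ is a function $f:[n]\to[n]$ with $|f^{ -1}(\{1,\dots,m\})|\ge m$ for all $m\in[n]$; $\mathrm{PF}_n$ is the set of these. Elements of $[n]$ are called labels. A parking function is identified with a labelled Dyck path from $(0,0)$ to $(n,n)$ (north and east unit steps, never below the diagonal $y=x$): the north steps on the line $x=i-1$ carry the labels in $f^{ -1}(i)$, increasing from bottom to top. So label $\lambda$ lies in column $f(\lambda)$, and the rows, numbered $1,\dots,n$ from bottom to top, each contain exactly one label (the labels ordered by increasing $f(\lambda)$, ties broken by increasing $\lambda$). Area: $a_\lambda(f)$ is the number of whole unit squares between the path and the main diagonal $y=x$ in the row containing $\lambda$; if $\lambda$ is in row $i$, then $a_\lambda(f)=i-f(\lambda)$. $\mathrm{area}(f)=\sum_{\lambda\in[n]}a_\lambda(f)$. Diagonal inversions: $\mathrm{Dinv}(f)$ is the set of pairs $\{\lambda,\mu\}\subseteq[n]$ with $\lambda<\mu$ such that either (A) $f(\lambda)<f(\mu)$ and $a_\lambda(f)=a_\mu(f)$, or (B) $f(\lambda)>f(\mu)$ and $a_\lambda(f)+1=a_\mu(f)$. The map $\phi_n$: the dinv reading word of $f$ is the word $w_1w_2\cdots w_n$ listing all labels in increasing order with respect to the total order in which $\lambda$ precedes $\mu$ iff $a_\lambda(f)<a_\mu(f)$, or $a_\lambda(f)=a_\mu(f)$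 and $f(\lambda)<f(\mu)$. For $\lambda=w_j$ set $d_\lambda(f)=\#\{\{w_i,w_j\}\in\mathrm{Dinv}(f) : i<j\}$. Then $\phi_n:\mathrm{PF}_n\to\mathrm{PF}_n$ is defined by $(\phi_n(f))(w_i)=i-d_{w_i}(f)$ for all $i\in[n]$ (this is indeed a parking function). Pmaj: for $g\in\mathrm{PF}_n$ the permutation $\sigma_{\mathrm{pmaj}}(g)=\sigma_1\cdots\sigma_n$ (one-line notation) is defined as follows. Set $B_0'=\varnothing$, $\sigma_0=n+1$. For $m=1,\dots,n$: let $B_m=B_{m-1}'\cup g^{ -1}(m)$ (always nonempty) and $X_m=\{a\in B_m: a<\sigma_{m-1}\}$; put $\sigma_m=\max X_m$ if $X_m\ne\varnothing$ and $\sigma_m=\max B_m$ otherwise; let $B_m'=B_m\setminus\{\sigma_m\}$. Then $\mathrm{pmaj}(g)=\mathrm{maj}(\sigma_n\sigma_{n-1}\cdots\sigma_1)$, where for a permutation $\tau$ of $[n]$, $\mathrm{maj}(\tau)=\sum_{i\in[n-1],\ \tau(i)>\tau(i+1)} i$. -}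

module Defs where

-- Labels, columns, rows and positions in [n] = {1,…,n} are all elements of
-- Fin n, so each is represented by its predecessor.  Only differences and
-- comparisons of them occur below, so the shift is harmless; the positions
-- weighting `maj` are genuine natural numbers starting from 1.

open import Data.Bool.Base using (if_then_else_)
open import Data.Fin.Base as Fin using (Fin; zero; suc; toℕ; fromℕ<; cast)
import Data.Fin.Properties as Fin
open import Data.Fin.Subset using (Subset; ∣_∣; ⊥; _∩_; _∪_; _-_)
open import Data.List.Base
  using (List; []; _∷_; length; lookup; filter; map; allFin; reverse)
  renaming (tabulate to tabulateᴸ)
open import Data.List.Membership.Propositional using (_∈_)
open import Data.List.Membership.Propositional.Properties using (∈-allFin; ∈-lookup)
open import Data.List.Properties using (length-tabulate)
open import Data.List.Relation.Binary.Permutation.Propositional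
  using (_↭_; ↭-sym; ↭⇒↭ₛ)
open import Data.List.Relation.Binary.Permutation.Propositional.Properties
  using (∈-resp-↭; ↭-length; filter-↭)
import Data.List.Relation.Binary.Permutation.Setoid.Properties as Permutation
open import Data.List.Relation.Unary.All as All using ()
open import Data.List.Relation.Unary.AllPairs using (_∷_)
open import Data.List.Relation.Unary.Any using (index)
open import Data.List.Relation.Unary.Any.Properties using (lookup-index)
open import Data.List.Relation.Unary.Unique.Propositional using (Unique)
open import Data.List.Relation.Unary.Unique.Propositional.Properties using (allFin⁺)
import Data.List.Sort.InsertionSort as InsertionSort
open import Data.List.Sort.Base using (module SortingAlgorithm)
open import Data.Maybe.Base using (Maybe; just; nothing; _<∣>_)
open import Data.Nat.Base using (ℕ; zero; suc; _+_; _∸_; _≤_; _<_; z≤n; s≤s)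
open import Data.Nat.ListAction using (sum)
import Data.Nat.Properties as ℕ
open import Data.Product.Base using (_×_; _,_)
open import Data.Product.Relation.Binary.Lex.NonStrict using (×-decTotalOrder)
open import Data.Sum.Base using (_⊎_)
open import Data.Vec.Base as Vec using ([]; _∷_)
open import Function.Base using (_∘_)
open import Level using (0ℓ)
open import Relation.Binary.Bundles using (DecTotalOrder)
import Relation.Binary.Construct.On as On
open import Relation.Binary.PropositionalEquality
  using (_≡_; refl; sym; trans; cong; subst; setoid)
open import Relation.Nullary.Decidable using (Dec; yes; no; does; _×-dec_; _⊎-dec_)
open import Relation.Nullary.Negation using (contradiction)
open import Relation.Unary using (Pred; Decidable)

private
  variable
    n : ℕ

------------------------------------------------------------------------
-- Finite sets

comprehension : {P : Pred (Fin n) 0ℓ} → Decidable P → Subset n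
comprehension P? = Vec.tabulate (does ∘ P?)

# : {P : Pred (Fin n) 0ℓ} → Decidable P → ℕ
# P? = ∣ comprehension P? ∣

-- `nothing` exactly for the empty set.
max : Subset n → Maybe (Fin n)
max []      = nothing
max (s ∷ p) with max p
... | just i  = just (suc i)
... | nothing = if s then just zero else nothing

------------------------------------------------------------------------
-- Parking functions

record PF (n : ℕ) : Set where
  field
    fun     : Fin n → Fin n
    parking : ∀ (m : Fin n) → suc (toℕ m) ≤ # (λ l → fun l Fin.≤? m)

open PF public

------------------------------------------------------------------------
-- Area

module _ (f : PF n) where

  -- μ lies in a lower row than l.
  Below : Fin n → Fin n → Set
  Below μ l = fun f μ Fin.< fun f l ⊎ (fun f μ ≡ fun f l × μ Fin.< l)

  below? : ∀ μ l → Dec (Below μ l)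
  below? μ l =
    (fun f μ Fin.<? fun f l) ⊎-dec ((fun f μ Fin.≟ fun f l) ×-dec (μ Fin.<? l))

  row : Fin n → ℕ
  row l = # (λ μ → below? μ l)

  -- The subtraction never truncates: by the parking condition at least
  -- toℕ (fun f l) labels lie in columns to the left of l.
  a : Fin n → ℕ
  a l = row l ∸ toℕ (fun f l)

  area : ℕ
  area = sum (map a (allFin n))

------------------------------------------------------------------------
-- Diagonal inversions

  -- Dinv l μ says that l < μ and {l, μ} belongs to Dinv(f).
  Dinv : Fin n → Fin n → Set
  Dinv l μ = l Fin.< μ ×
    ( (fun f l Fin.< fun f μ × a l ≡ a μ)
    ⊎ (fun f μ Fin.< fun f l × suc (a l) ≡ a μ))

  dinv? : ∀ l μ → Dec (Dinv l μ)
  dinv? l μ = (l Fin.<? μ) ×-dec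
    (    ((fun f l Fin.<? fun f μ) ×-dec (a l ℕ.≟ a μ))
    ⊎-dec ((fun f μ Fin.<? fun f l) ×-dec (suc (a l) ℕ.≟ a μ)))

  -- Membership of the unordered pair.
  InDinv : Fin n → Fin n → Set
  InDinv l μ = Dinv l μ ⊎ Dinv μ l

  inDinv? : ∀ l μ → Dec (InDinv l μ)
  inDinv? l μ = dinv? l μ ⊎-dec dinv? μ l

------------------------------------------------------------------------
-- The dinv reading word

  -- Lexicographic comparison of the pairs (a l , fun f l).  Distinct labels
  -- have distinct pairs, since a l + fun f l is the row of l.
  readingOrder : DecTotalOrder 0ℓ 0ℓ 0ℓ
  readingOrder = On.decTotalOrder
    (×-decTotalOrder ℕ.≤-decTotalOrder (Fin.≤-decTotalOrder n))
    (λ (l : Fin n) → a l , fun f l)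

  private
    module Sort = InsertionSort readingOrder

  readingWord : List (Fin n)
  readingWord = Sort.sort (allFin n)

  readingWord-↭ : readingWord ↭ allFin n
  readingWord-↭ = SortingAlgorithm.sort-↭ Sort.insertionSort (allFin n)

  length-readingWord : length readingWord ≡ n
  length-readingWord = trans (↭-length readingWord-↭) (length-tabulate (λ i → i))

  ∈-readingWord : ∀ l → l ∈ readingWord
  ∈-readingWord l = ∈-resp-↭ (↭-sym readingWord-↭) (∈-allFin l)

  w : Fin n → Fin n
  w i = lookup readingWord (cast (sym length-readingWord) i)

  position : Fin n → Fin n
  position l = cast length-readingWord (index (∈-readingWord l))

  w-position : ∀ l → w (position l) ≡ l
  w-position l = trans
    (cong (lookup readingWord)
      (Fin.cast-involutive (sym length-readingWord) length-readingWord _))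
    (sym (lookup-index (∈-readingWord l)))

------------------------------------------------------------------------
-- The map φ

  d : Fin n → ℕ
  d l = # (λ i → (i Fin.<? position l) ×-dec inDinv? (w i) l)

  -- The subtraction never truncates: d l counts positions before that of l.
  φ-fun : Fin n → Fin n
  φ-fun l = fromℕ< {toℕ (position l) ∸ d l}
    (ℕ.≤-<-trans (ℕ.m∸n≤m (toℕ (position l)) (d l)) (Fin.toℕ<n (position l)))

private
  lookup-injective : {A : Set} {xs : List A} → Unique xs →
                     ∀ i j → lookup xs i ≡ lookup xs j → i ≡ j
  lookup-injective {xs = x ∷ xs} _        zero    zero    _  = refl
  lookup-injective {xs = x ∷ xs} (p ∷ _)  zero    (suc j) eq =
    contradiction eq (All.lookup p (∈-lookup j))
  lookup-injective {xs = x ∷ xs} (p ∷ _)  (suc i) zero    eq =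
    contradiction (sym eq) (All.lookup p (∈-lookup i))
  lookup-injective {xs = x ∷ xs} (_ ∷ ps) (suc i) (suc j) eq =
    cong suc (lookup-injective ps i j eq)

  ∣tabulate∣ : {A : Set} {P : Pred A 0ℓ} (P? : Decidable P) (h : Fin n → A) →
               ∣ Vec.tabulate (does ∘ P? ∘ h) ∣ ≡ length (filter P? (tabulateᴸ h))
  ∣tabulate∣ {zero}  P? h = refl
  ∣tabulate∣ {suc n} P? h with P? (h zero)
  ... | yes _ = cong suc (∣tabulate∣ P? (h ∘ suc))
  ... | no  _ = ∣tabulate∣ P? (h ∘ suc)

  prefix≤filter : {A : Set} {P : Pred A 0ℓ} (P? : Decidable P) (xs : List A) (k : ℕ) →
                  k ≤ length xs → (∀ j → toℕ j < k → P (lookup xs j)) →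
                  k ≤ length (filter P? xs)
  prefix≤filter P? xs       zero    _         _ = z≤n
  prefix≤filter P? (x ∷ xs) (suc k) (s≤s k≤n) h with P? x
  ... | yes _  = s≤s (prefix≤filter P? xs k k≤n (λ j j<k → h (suc j) (s≤s j<k)))
  ... | no ¬px = contradiction (h zero (s≤s z≤n)) ¬px

module _ (f : PF n) where

  readingWord-unique : Unique (readingWord f)
  readingWord-unique = Permutation.Unique-resp-↭ (setoid (Fin n))
    (↭⇒↭ₛ (↭-sym (readingWord-↭ f))) (allFin⁺ n)

  index-lookup : ∀ j → index (∈-readingWord f (lookup (readingWord f) j)) ≡ j
  index-lookup j = lookup-injective readingWord-unique _ _
    (sym (lookup-index (∈-readingWord f (lookup (readingWord f) j))))

  position-w : ∀ i → position f (w f i) ≡ i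
  position-w i = trans
    (cong (cast (length-readingWord f)) (index-lookup _))
    (Fin.cast-involutive (length-readingWord f) (sym (length-readingWord f)) i)

  φ-parking : ∀ (m : Fin n) → suc (toℕ m) ≤ # (λ l → φ-fun f l Fin.≤? m)
  φ-parking m = subst (suc (toℕ m) ≤_)
    (sym (trans (∣tabulate∣ P? (λ l → l)) (↭-length (filter-↭ P? (↭-sym (readingWord-↭ f))))))
    (prefix≤filter P? (readingWord f) (suc (toℕ m))
      (subst (suc (toℕ m) ≤_) (sym (length-readingWord f)) (Fin.toℕ<n m)) early)
    where
    P? : Decidable (λ l → φ-fun f l Fin.≤ m)
    P? l = φ-fun f l Fin.≤? m

    early : ∀ j → toℕ j < suc (toℕ m) → φ-fun f (lookup (readingWord f) j) Fin.≤ m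
    early j (s≤s j≤m) = begin
      toℕ (φ-fun f l)                          ≡⟨ Fin.toℕ-fromℕ< _ ⟩
      toℕ (position f l) ∸ d f l               ≤⟨ ℕ.m∸n≤m _ (d f l) ⟩
      toℕ (position f l)                       ≡⟨ Fin.toℕ-cast _ (index (∈-readingWord f l)) ⟩
      toℕ (index (∈-readingWord f l))          ≡⟨ cong toℕ (index-lookup j) ⟩
      toℕ j                                    ≤⟨ j≤m ⟩
      toℕ m                                    ∎
      where
      open ℕ.≤-Reasoning
      l = lookup (readingWord f) j

  φ : PF n
  φ = record { fun = φ-fun f ; parking = φ-parking }

------------------------------------------------------------------------
-- The major index of a word

majFrom : ℕ → List (Fin n) → ℕ
majFrom i []            = 0
majFrom i (x ∷ [])      = 0
majFrom i (x ∷ (y ∷ v)) =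
  (if does (y Fin.<? x) then i else 0) + majFrom (suc i) (y ∷ v)

maj : List (Fin n) → ℕ
maj = majFrom 1

------------------------------------------------------------------------
-- pmaj

-- choose s B is max X if X = {x ∈ B : x < s} is nonempty, else max B.
choose : ℕ → Subset n → Maybe (Fin n)
choose s B = max (B ∩ comprehension (λ x → toℕ x ℕ.<? s)) <∣> max B

module _ (g : PF n) where

  fibre : Fin n → Subset n
  fibre m = comprehension (λ l → fun g l Fin.≟ m)

  -- σFrom B′ s ms runs the procedure over the remaining columns ms, where B′
  -- is the current leftover set and s the last chosen label.  The `nothing`
  -- case is unreachable from `σpmaj`, since for a parking function B is never
  -- empty.
  σFrom : Subset n → ℕ → List (Fin n) → List (Fin n)
  σFrom B′ s []       = []
  σFrom B′ s (m ∷ ms) with choose s (B′ ∪ fibre m)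
  ... | nothing = []
  ... | just x  = x ∷ σFrom ((B′ ∪ fibre m) - x) (toℕ x) ms

  -- Since labels are shifted down by one, σ₀ = n + 1 becomes n.
  σpmaj : List (Fin n)
  σpmaj = σFrom ⊥ n (allFin n)

  pmaj : ℕ
  pmaj = maj (reverse σpmaj)

{-# OPTIONS --safe #-}
module Submission where

open import Data.Bool.Base using (if_then_else_)
open import Data.Fin.Base as Fin using (Fin; zero; suc; toℕ; fromℕ<; inject₁; punchOut)
import Data.Fin.Properties as Fin
open import Data.Fin.Subset using (Subset; ∣_∣; ⊥; _∪_; _∩_; _-_; _∈_; _∉_; inside; outside)
open import Data.Fin.Subset.Properties
open import Data.List.Base
  using (List; []; _∷_; _∷ʳ_; length; map; allFin; reverse; tabulate)
open import Data.List.Membership.Propositional using () renaming (_∈_ to _∈ᴸ_)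
open import Data.List.Membership.Propositional.Properties using (∈-allFin; ∈-tabulate⁺)
open import Data.List.Membership.Propositional.Properties.WithK using (unique∧set⇒bag)
import Data.List.Properties as List
open import Data.List.Relation.Binary.BagAndSetEquality using (∼bag⇒↭)
open import Data.List.Relation.Binary.Permutation.Propositional using (_↭_)
open import Data.List.Relation.Binary.Permutation.Propositional.Properties using (map⁺)
open import Data.List.Relation.Unary.Linked using (Linked; []; [-]; _∷_)
open import Data.List.Relation.Unary.Sorted.TotalOrder.Properties using (lookup-mono-≤)
open import Data.List.Relation.Unary.Unique.Propositional.Properties using (tabulate⁺; allFin⁺)
open import Data.List.Sort.Base using (module SortingAlgorithm)
import Data.List.Sort.InsertionSort as InsertionSort
open import Data.Maybe.Base using (just; nothing)
open import Data.Nat.Base using (ℕ; zero; suc; _+_; _*_; _∸_; _≤_; _<_; z≤n; s≤s)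
open import Data.Nat.ListAction using (sum)
open import Data.Nat.ListAction.Properties using (sum-↭)
import Data.Nat.Properties as ℕ
open import Data.Nat.Solver using (module +-*-Solver)
open import Data.Product.Base using (∃-syntax; _×_; _,_; proj₁; proj₂)
open import Data.Product.Relation.Binary.Lex.Strict using (×-isStrictTotalOrder)
open import Data.Sum.Base using (_⊎_; inj₁; inj₂)
open import Data.Vec.Base using ([]; _∷_; here; there)
import Data.Vec.Properties as Vec
open import Function.Base using (_∘_)
open import Function.Bundles using (mk⇔)
open import Level using (0ℓ)
open import Relation.Binary.Bundles using (DecTotalOrder)
import Relation.Binary.Construct.Flip.EqAndOrd as Flip
import Relation.Binary.Construct.On as On
open import Relation.Binary.Core using (Rel)
open import Relation.Binary.Definitions using (tri<; tri≈; tri>) renaming (Decidable to Decidable₂)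
open import Relation.Binary.PropositionalEquality
open import Relation.Binary.Structures using (IsStrictTotalOrder)
open import Relation.Nullary.Decidable
  using (Dec; yes; no; does; dec-true; dec-false; _×-dec_; _⊎-dec_; ¬?)
open import Relation.Nullary.Negation using (¬_; contradiction)
open import Relation.Unary using (Pred; Decidable)
open import Defs

-- The pmaj procedure on φ f picks the labels level by level, by increasing area a, and in
-- decreasing order within a level.  Indeed φ f places l in column 1 + #{μ read before l that
-- form no diagonal inversion with l}, and all these μ are picked before l, so l is available
-- in time.  A label x that would be preferred to the label y due now is not yet available:
-- everything picked before y is counted for x, and so is one further label.  The latter is
-- y itself if x lies at least two levels above y; otherwise it is obtained by following the
-- path down from x to the last row of area a x - 1: if the label there is smaller than x it
-- is counted, and otherwise the label above it, which exceeds x and has the same area, is.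
-- The same argument shows that the minimum of a level is below the maximum of the next one,
-- so the ascents of the word are exactly the level changes.  In the reversed word each of
-- them is a descent, at the position equal to the number of labels of higher level, and these
-- numbers add up to the area.

private
  variable
    m n : ℕ

-- Counting in finite sets.

module _ {P : Pred (Fin n) 0ℓ} (P? : Decidable P) where

  ∈-comprehension⁺ : ∀ {x} → P x → x ∈ comprehension P?
  ∈-comprehension⁺ {x} p = Vec.lookup⇒[]= x _
    (trans (Vec.lookup∘tabulate (does ∘ P?) x) (dec-true (P? x) p))

  ∈-comprehension⁻ : ∀ {x} → x ∈ comprehension P? → P x
  ∈-comprehension⁻ {x} x∈ with P? x | trans (sym (Vec.lookup∘tabulate (does ∘ P?) x)) (Vec.[]=⇒lookup x∈)
  ... | yes p | _ = p

x∈p-y⇒x≢y : ∀ {x y} (p : Subset n) → x ∈ p - y → x ≢ y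
x∈p-y⇒x≢y {y = zero}  (inside  ∷ p) () refl
x∈p-y⇒x≢y {y = zero}  (outside ∷ p) () refl
x∈p-y⇒x≢y {y = suc y} (_ ∷ p) (there x∈) refl = x∈p-y⇒x≢y p x∈ refl

-- The two ambient sizes differ so that the induction can drop the first point of the domain and
-- delete only its image from `q`.
injection⇒∣p∣≤∣q∣ : (p : Subset m) (q : Subset n) (f : Fin m → Fin n) →
                    (∀ {i j} → f i ≡ f j → i ≡ j) →
                    (∀ {i} → i ∈ p → f i ∈ q) → ∣ p ∣ ≤ ∣ q ∣
injection⇒∣p∣≤∣q∣ []            q f inj f∈q = z≤n
injection⇒∣p∣≤∣q∣ (outside ∷ p) q f inj f∈q =
  injection⇒∣p∣≤∣q∣ p q (f ∘ suc) (Fin.suc-injective ∘ inj) (f∈q ∘ there)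
injection⇒∣p∣≤∣q∣ (inside  ∷ p) q f inj f∈q = ℕ.≤-trans
  (s≤s (injection⇒∣p∣≤∣q∣ p (q - f zero) (f ∘ suc) (Fin.suc-injective ∘ inj)
    (λ i∈p → x∈p∧x≢y⇒x∈p-y (f∈q (there i∈p)) (λ eq → contradiction (inj eq) λ ()))))
  (x∈p⇒∣p-x∣<∣p∣ (f∈q here))

module _ {P : Pred (Fin m) 0ℓ} {Q : Pred (Fin n) 0ℓ} (P? : Decidable P) (Q? : Decidable Q) where

  #-mono-≤ : (f : Fin m → Fin n) → (∀ {i j} → f i ≡ f j → i ≡ j) →
             (∀ {i} → P i → Q (f i)) → # P? ≤ # Q?
  #-mono-≤ f inj P⇒Q = injection⇒∣p∣≤∣q∣ _ _ f inj
    (∈-comprehension⁺ Q? ∘ P⇒Q ∘ ∈-comprehension⁻ P?)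

module _ {P Q : Pred (Fin n) 0ℓ} (P? : Decidable P) (Q? : Decidable Q) where

  #-mono-< : ∀ {e} → (∀ {i} → P i → Q i) → Q e → ¬ P e → # P? < # Q?
  #-mono-< {e} P⇒Q qe ¬pe = p⊂q⇒∣p∣<∣q∣
    ( ∈-comprehension⁺ Q? ∘ P⇒Q ∘ ∈-comprehension⁻ P?
    , e , ∈-comprehension⁺ Q? qe , ¬pe ∘ ∈-comprehension⁻ P?)

#-split : ∀ {n} {P Q : Pred (Fin n) 0ℓ} (P? : Decidable P) (Q? : Decidable Q) →
          # P? ≡ # (λ i → P? i ×-dec Q? i) + # (λ i → P? i ×-dec ¬? (Q? i))
#-split {zero}  P? Q? = refl
#-split {suc n} P? Q? with P? zero | Q? zero | #-split (P? ∘ suc) (Q? ∘ suc)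
... | yes _ | yes _ | eq = cong suc eq
... | yes _ | no  _ | eq = trans (cong suc eq) (sym (ℕ.+-suc _ _))
... | no  _ | yes _ | eq = eq
... | no  _ | no  _ | eq = eq

#-none : ∀ {n} {P : Pred (Fin n) 0ℓ} (P? : Decidable P) → (∀ i → ¬ P i) → # P? ≡ 0
#-none {zero}  P? ¬P = refl
#-none {suc n} P? ¬P with P? zero
... | yes p = contradiction p (¬P zero)
... | no  _ = #-none (P? ∘ suc) (¬P ∘ suc)

#<k : ∀ {n} (k : Fin n) → # (λ (i : Fin n) → i Fin.<? k) ≡ toℕ k
#<k {suc n} zero    = #-none (λ (i : Fin (suc n)) → i Fin.<? zero {n}) (λ _ ())
#<k {suc n} (suc k) = cong suc (#<k k)

-- Evaluating `max` and `choose`.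

max-nothing : (p : Subset n) → (∀ x → x ∉ p) → max p ≡ nothing
max-nothing []            empty = refl
max-nothing (inside  ∷ p) empty = contradiction here (empty zero)
max-nothing (outside ∷ p) empty rewrite max-nothing p (λ x → empty (suc x) ∘ there) = refl

max-just : ∀ (p : Subset n) {y} → y ∈ p → (∀ {x} → x ∈ p → x Fin.≤ y) → max p ≡ just y
max-just (inside ∷ p) {zero} here ub
  rewrite max-nothing p (λ x x∈p → contradiction (ub (there x∈p)) λ ()) = refl
max-just (s ∷ p) {suc y} (there y∈p) ub
  rewrite max-just p y∈p (λ x∈p → ℕ.≤-pred (ub (there x∈p))) = refl

module _ (s : ℕ) (B : Subset n) {y : Fin n} (y∈B : y ∈ B) where

  private
    <s? : Decidable (λ (x : Fin n) → toℕ x < s)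
    <s? x = toℕ x ℕ.<? s

  choose-below : toℕ y < s → (∀ {x} → x ∈ B → toℕ x < s → x Fin.≤ y) → choose s B ≡ just y
  choose-below y<s ub rewrite max-just (B ∩ comprehension <s?)
    (x∈p∩q⁺ (y∈B , ∈-comprehension⁺ <s? y<s))
    (λ x∈ → let x∈B , x<s = x∈p∩q⁻ B _ x∈ in ub x∈B (∈-comprehension⁻ <s? x<s)) = refl

  choose-wrap : (∀ {x} → x ∈ B → ¬ toℕ x < s) → (∀ {x} → x ∈ B → x Fin.≤ y) → choose s B ≡ just y
  choose-wrap ≮s ub rewrite max-nothing (B ∩ comprehension <s?)
    (λ x x∈ → let x∈B , x<s = x∈p∩q⁻ B _ x∈ in ≮s x∈B (∈-comprehension⁻ <s? x<s)) =
    max-just B y∈B ub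

-- Injections of a finite set and tabulated words.

injective⇒surjective : ∀ {n} (f : Fin n → Fin n) → (∀ {i j} → f i ≡ f j → i ≡ j) →
                       ∀ j → ∃[ i ] f i ≡ j
injective⇒surjective {suc n} f inj j with Fin.any? (λ i → f i Fin.≟ j)
... | yes found  = found
-- A missed value `j` could be punched out of the codomain, leaving an injection into a smaller set.
... | no  ¬found = contradiction
  (Fin.injective⇒≤ {f = λ i → punchOut {i = j} (λ j≡fi → ¬found (i , sym j≡fi))}
    (inj ∘ Fin.punchOut-injective {i = j} _ _)) ℕ.1+n≰n

σFrom-∷ : ∀ (g : PF n) B′ s m ms {x} → choose s (B′ ∪ fibre g m) ≡ just x →
          σFrom g B′ s (m ∷ ms) ≡ x ∷ σFrom g ((B′ ∪ fibre g m) - x) (toℕ x) ms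
σFrom-∷ g B′ s m ms eq rewrite eq = refl

Linked-tabulate : ∀ {A : Set} {R : Rel A 0ℓ} {n} (h : Fin n → A) →
                  (∀ {i j} → toℕ j ≡ suc (toℕ i) → R (h i) (h j)) → Linked R (tabulate h)
Linked-tabulate {n = 0}           h step = []
Linked-tabulate {n = 1}           h step = [-]
Linked-tabulate {n = suc (suc n)} h step = step refl ∷ Linked-tabulate (h ∘ suc) (step ∘ cong suc)

tabulate-↭ : (h : Fin n → Fin n) → (∀ {i j} → h i ≡ h j → i ≡ j) → tabulate h ↭ allFin n
tabulate-↭ {n} h inj = ∼bag⇒↭ (unique∧set⇒bag (tabulate⁺ inj) (allFin⁺ n)
  (mk⇔ (λ _ → ∈-allFin _) (λ _ → member _)))
  where
  member : ∀ x → x ∈ᴸ tabulate h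
  member x = let i , hi≡x = injective⇒surjective h inj x in
    subst (_∈ᴸ tabulate h) hi≡x (∈-tabulate⁺ i)

-- Major index of a reversed word.

descentAt : ℕ → Fin n → Fin n → ℕ
descentAt i x y = if does (y Fin.<? x) then i else 0

-- Reversal appends at the end what `majFrom` consumes from the front; the new last pair sits
-- `length xs` places after the start `i`.
majFrom-∷ʳ : ∀ i (xs : List (Fin n)) y x →
             majFrom i ((xs ∷ʳ y) ∷ʳ x) ≡ majFrom i (xs ∷ʳ y) + descentAt (i + length xs) y x
majFrom-∷ʳ i []           y x =
  trans (ℕ.+-identityʳ _) (cong (λ k → descentAt k y x) (sym (ℕ.+-identityʳ i)))
majFrom-∷ʳ i (z ∷ [])     y x = begin
  descentAt i z y + (descentAt (suc i) y x + 0)   ≡⟨ cong (descentAt i z y +_) (ℕ.+-identityʳ _) ⟩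
  descentAt i z y + descentAt (suc i) y x         ≡⟨ cong₂ (λ c k → c + descentAt k y x)
    (ℕ.+-identityʳ (descentAt i z y)) (ℕ.+-comm i 1) ⟨
  descentAt i z y + 0 + descentAt (i + 1) y x     ∎
  where open ≡-Reasoning
majFrom-∷ʳ i (z ∷ t ∷ xs) y x = begin
  descentAt i z t + majFrom (suc i) ((t ∷ xs ∷ʳ y) ∷ʳ x)
    ≡⟨ cong (descentAt i z t +_) (majFrom-∷ʳ (suc i) (t ∷ xs) y x) ⟩
  descentAt i z t + (majFrom (suc i) (t ∷ xs ∷ʳ y) + descentAt (suc i + length (t ∷ xs)) y x)
    ≡⟨ ℕ.+-assoc (descentAt i z t) _ _ ⟨
  descentAt i z t + majFrom (suc i) (t ∷ xs ∷ʳ y) + descentAt (suc i + length (t ∷ xs)) y x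
    ≡⟨ cong (λ k → descentAt i z t + majFrom (suc i) (t ∷ xs ∷ʳ y) + descentAt k y x)
         (ℕ.+-suc i (length (t ∷ xs))) ⟨
  descentAt i z t + majFrom (suc i) (t ∷ xs ∷ʳ y) + descentAt (i + length (z ∷ t ∷ xs)) y x
    ∎
  where open ≡-Reasoning

maj-reverse-∷ : ∀ (x y : Fin n) ys →
                maj (reverse (x ∷ y ∷ ys)) ≡
                maj (reverse (y ∷ ys)) + descentAt (length (y ∷ ys)) y x
maj-reverse-∷ x y ys
  rewrite List.unfold-reverse x (y ∷ ys) | List.unfold-reverse y ys
        | majFrom-∷ʳ 1 (reverse ys) y x | List.length-reverse ys = refl

LevelStep : (Fin n → ℕ) → Rel (Fin n) 0ℓ
LevelStep A x y = (A x ≡ A y × y Fin.< x) ⊎ (suc (A x) ≡ A y × x Fin.< y)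

-- A rise of level contributes the number of labels from there on, that is, one unit for each label
-- whose level it raises. So `maj` measures levels relative to that of the first label, and the
-- product on the left restores this offset.
maj-reverse-levels : ∀ (A : Fin n → ℕ) x xs →
  Linked (LevelStep A) (x ∷ xs) →
  maj (reverse (x ∷ xs)) + length (x ∷ xs) * A x ≡ sum (map A (x ∷ xs))
maj-reverse-levels A x []       _             = refl
maj-reverse-levels A x (y ∷ ys) (step ∷ rest)
  rewrite maj-reverse-∷ x y ys | sym (maj-reverse-levels A y ys rest) with step
... | inj₁ (level , y<x) rewrite dec-false (x Fin.<? y) (ℕ.<-asym y<x) | level =
  solve 3 (λ M l b → M :+ con 0 :+ (b :+ l) := b :+ (M :+ l)) refl
    (maj (reverse (y ∷ ys))) (length (y ∷ ys) * A y) (A y)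
  where open +-*-Solver
... | inj₂ (up , x<y) rewrite dec-true (x Fin.<? y) x<y | sym up =
  solve 3 (λ M l b → M :+ l :+ (b :+ l :* b) := b :+ (M :+ l :* (con 1 :+ b))) refl
    (maj (reverse (y ∷ ys))) (length (y ∷ ys)) (A x)
  where open +-*-Solver

maj-reverse-tabulate : ∀ {k} (A : Fin n → ℕ) (h : Fin k → Fin n) →
  (∀ {i} → toℕ i ≡ 0 → A (h i) ≡ 0) →
  (∀ {i j} → toℕ j ≡ suc (toℕ i) → LevelStep A (h i) (h j)) →
  maj (reverse (tabulate h)) ≡ sum (map A (tabulate h))
maj-reverse-tabulate {k = zero}  A h start step = refl
maj-reverse-tabulate {k = suc _} A h start step = begin
  M                         ≡⟨ ℕ.+-identityʳ M ⟨
  M + 0                     ≡⟨ cong (M +_) (ℕ.*-zeroʳ L) ⟨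
  M + L * 0                 ≡⟨ cong (λ b → M + L * b) (start refl) ⟨
  M + L * A (h zero)        ≡⟨ maj-reverse-levels A _ _ (Linked-tabulate h step) ⟩
  sum (map A (tabulate h))  ∎
  where
  open ≡-Reasoning
  M = maj (reverse (tabulate h))
  L = length (tabulate h)

-- Running the pmaj procedure along a given ranking.

Previous : (Fin n → ℕ) → ℕ → Fin n → Set
Previous {n} rank s y = (s ≡ n × rank y ≡ 0) ⊎ (∃[ p ] (s ≡ toℕ p × rank y ≡ suc (rank p)))

module _ (g : PF n) (rank : Fin n → ℕ) (unrank : Fin n → Fin n)
  (rank-unrank : ∀ i → rank (unrank i) ≡ toℕ i)
  (rank-injective : ∀ {x y} → rank x ≡ rank y → x ≡ y)
  (g≤rank : ∀ x → toℕ (fun g x) ≤ rank x)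
  (choose-next : ∀ {s y} (B : Subset n) → Previous rank s y → y ∈ B →
                 (∀ {x} → x ∈ B → toℕ (fun g x) ≤ rank y × rank y ≤ rank x) →
                 choose s B ≡ just y)
  where

  -- Invariant: before column `m` the leftover set consists of the labels that arrived earlier and
  -- have rank at least `m`. The bound `g≤rank` makes the label of rank `m` available now, and keeps
  -- newly arrived labels from having had their turn already.
  σFrom-unrank : ∀ {k m} (h : Fin k → Fin n) → (∀ i → toℕ (h i) ≡ toℕ i + m) →
                 ∀ B′ s → (∀ y → rank y ≡ m → Previous rank s y) →
                 (∀ {x} → x ∈ B′ → toℕ (fun g x) < m × m ≤ rank x) →
                 (∀ {x} → toℕ (fun g x) < m → m ≤ rank x → x ∈ B′) →
                 σFrom g B′ s (tabulate h) ≡ tabulate (unrank ∘ h)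
  σFrom-unrank {zero}  h toℕ-h B′ s prev ∈⁻ ∈⁺ = refl
  σFrom-unrank {suc k} {m} h toℕ-h B′ s prev ∈⁻ ∈⁺ =
    trans (σFrom-∷ g B′ s column _ (choose-next B (prev y rank-y) y∈B eligible))
    (cong (y ∷_) (σFrom-unrank (h ∘ suc) (λ i → trans (toℕ-h (suc i)) (sym (ℕ.+-suc (toℕ i) m)))
      (B - y) (toℕ y)
      (λ z eq → inj₂ (y , refl , trans eq (cong suc (sym rank-y))))
      (λ {x} x∈ → let x∈B = p─q⊆p B _ x∈ ; g≤ , m≤ = B⁻ x∈B in
        s≤s g≤ , ℕ.≤∧≢⇒< m≤ (λ eq → x∈p-y⇒x≢y B x∈ (rank-injective (trans (sym eq) (sym rank-y)))))
      (λ {x} g< m< → x∈p∧x≢y⇒x∈p-y (B⁺ (ℕ.≤-pred g<) (ℕ.<⇒≤ m<))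
        (λ { refl → ℕ.<⇒≢ m< (sym rank-y) }))))
    where
    column = h zero
    in-column? : Decidable (λ x → fun g x ≡ column)
    in-column? x = fun g x Fin.≟ column

    y : Fin n
    y = unrank column

    B : Subset n
    B = B′ ∪ fibre g column

    rank-y : rank y ≡ m
    rank-y = trans (rank-unrank column) (toℕ-h zero)

    B⁻ : ∀ {x} → x ∈ B → toℕ (fun g x) ≤ m × m ≤ rank x
    B⁻ {x} x∈B with x∈p∪q⁻ B′ _ x∈B
    ... | inj₁ x∈B′ = let g< , m≤ = ∈⁻ x∈B′ in ℕ.<⇒≤ g< , m≤
    ... | inj₂ x∈fibre = ℕ.≤-reflexive g≡m , subst (_≤ rank x) g≡m (g≤rank x)
      where
      g≡m : toℕ (fun g x) ≡ m
      g≡m = trans (cong toℕ (∈-comprehension⁻ in-column? x∈fibre)) (toℕ-h zero)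

    B⁺ : ∀ {x} → toℕ (fun g x) ≤ m → m ≤ rank x → x ∈ B
    B⁺ g≤ m≤ with ℕ.m≤n⇒m<n∨m≡n g≤
    ... | inj₁ g< = x∈p∪q⁺ (inj₁ (∈⁺ g< m≤))
    ... | inj₂ g≡ = x∈p∪q⁺ {p = B′} (inj₂ (∈-comprehension⁺ in-column?
      (Fin.toℕ-injective (trans g≡ (sym (toℕ-h zero))))))

    y∈B : y ∈ B
    y∈B = B⁺ (ℕ.≤-trans (g≤rank y) (ℕ.≤-reflexive rank-y)) (ℕ.≤-reflexive (sym rank-y))

    eligible : ∀ {x} → x ∈ B → toℕ (fun g x) ≤ rank y × (rank y ≤ rank x)
    eligible {x} x∈B = let g≤ , m≤ = B⁻ x∈B in
      subst (toℕ (fun g x) ≤_) (sym rank-y) g≤ , subst (_≤ rank x) (sym rank-y) m≤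

  σpmaj-by-rank : σpmaj g ≡ tabulate unrank
  σpmaj-by-rank = σFrom-unrank (λ i → i) (λ i → sym (ℕ.+-identityʳ (toℕ i))) ⊥ n
    (λ y first → inj₁ (refl , first)) (λ x∈⊥ → contradiction x∈⊥ ∉⊥) (λ ())

-- Ranks in a finite strict total order.

module Rank {_≈_ _≺_ : Rel (Fin n) 0ℓ} (sto : IsStrictTotalOrder _≈_ _≺_)
            (≈⇒≡ : ∀ {x y} → x ≈ y → x ≡ y) (_≺?_ : Decidable₂ _≺_) where

  open IsStrictTotalOrder sto using (compare; module Eq) renaming (trans to ≺-trans; irrefl to ≺-irrefl)

  rank : Fin n → ℕ
  rank x = # (λ y → y ≺? x)

  ≺-irreflexive : ∀ {x} → ¬ x ≺ x
  ≺-irreflexive = ≺-irrefl Eq.refl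

  rank-mono : ∀ {x y} → x ≺ y → rank x < rank y
  rank-mono {x} {y} x≺y =
    #-mono-< (_≺? x) (_≺? y) (λ z≺x → ≺-trans z≺x x≺y) x≺y ≺-irreflexive

  ≺-connex : ∀ x y → x ≺ y ⊎ x ≡ y ⊎ y ≺ x
  ≺-connex x y with compare x y
  ... | tri< x≺y _ _ = inj₁ x≺y
  ... | tri≈ _ x≈y _ = inj₂ (inj₁ (≈⇒≡ x≈y))
  ... | tri> _ _ y≺x = inj₂ (inj₂ y≺x)

  rank-injective : ∀ {x y} → rank x ≡ rank y → x ≡ y
  rank-injective {x} {y} eq with ≺-connex x y
  ... | inj₁ x≺y        = contradiction eq (ℕ.<⇒≢ (rank-mono x≺y))
  ... | inj₂ (inj₁ x≡y) = x≡y
  ... | inj₂ (inj₂ y≺x) = contradiction (sym eq) (ℕ.<⇒≢ (rank-mono y≺x))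

  rank-cancel : ∀ {x y} → rank x < rank y → x ≺ y
  rank-cancel {x} {y} lt with ≺-connex x y
  ... | inj₁ x≺y         = x≺y
  ... | inj₂ (inj₁ refl) = contradiction lt (ℕ.<-irrefl refl)
  ... | inj₂ (inj₂ y≺x)  = contradiction lt (ℕ.<-asym (rank-mono y≺x))

  rank<n : ∀ x → rank x < n
  rank<n x = subst (rank x <_) (∣⊤∣≡n n)
    (p⊂q⇒∣p∣<∣q∣ ((λ _ → ∈⊤) , x , ∈⊤ , ≺-irreflexive ∘ ∈-comprehension⁻ (_≺? x)))

  private
    rankFin : Fin n → Fin n
    rankFin x = fromℕ< (rank<n x)

    toℕ-rankFin : ∀ x → toℕ (rankFin x) ≡ rank x
    toℕ-rankFin x = Fin.toℕ-fromℕ< (rank<n x)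

    preimage : ∀ i → ∃[ x ] rankFin x ≡ i
    preimage = injective⇒surjective rankFin λ {x} {y} eq → rank-injective
      (trans (sym (toℕ-rankFin x)) (trans (cong toℕ eq) (toℕ-rankFin y)))

  rank-cancel-≤ : ∀ {x y} → rank x ≤ rank y → y ≡ x ⊎ x ≺ y
  rank-cancel-≤ le with ℕ.m≤n⇒m<n∨m≡n le
  ... | inj₁ lt = inj₂ (rank-cancel lt)
  ... | inj₂ eq = inj₁ (rank-injective (sym eq))

  unrank : Fin n → Fin n
  unrank i = proj₁ (preimage i)

  rank-unrank : ∀ i → rank (unrank i) ≡ toℕ i
  rank-unrank i = trans (sym (toℕ-rankFin _)) (cong toℕ (proj₂ (preimage i)))

  unrank-injective : ∀ {i j} → unrank i ≡ unrank j → i ≡ j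
  unrank-injective {i} {j} eq = Fin.toℕ-injective
    (trans (sym (rank-unrank i)) (trans (cong rank eq) (rank-unrank j)))

  ≺-successor : ∀ {x y z} → rank y ≡ suc (rank x) → z ≺ y → z ≡ x ⊎ z ≺ x
  ≺-successor {x} {y} {z} eq z≺y with ≺-connex z x
  ... | inj₁ z≺x        = inj₂ z≺x
  ... | inj₂ (inj₁ z≡x) = inj₁ z≡x
  ... | inj₂ (inj₂ x≺z) = contradiction
    (ℕ.≤-trans (s≤s (rank-mono x≺z)) (subst (rank z <_) eq (rank-mono z≺y))) (ℕ.<-irrefl refl)

-- Rows and areas along the path.

module _ (f : PF n) where

  private
    col : Fin n → ℕ
    col l = toℕ (fun f l)

  -- With `below?` as decision procedure, the rank is `row f` by definition. Labels are the second
  -- lexicographic coordinate, so `proj₂` turns the componentwise equality into equality of labels.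
  open Rank
    (On.isStrictTotalOrder (λ l → fun f l , l)
      (×-isStrictTotalOrder Fin.<-isStrictTotalOrder Fin.<-isStrictTotalOrder))
    proj₂ (below? f)
    using ()
    renaming ( rank-mono to row-mono; rank-cancel to row-cancel; rank-injective to row-injective
             ; rank<n to row<n; unrank to unrow; rank-unrank to row-unrow)

  -- Unless `l` is in the first column, the parking condition at the preceding column supplies at
  -- least `col l` labels further left, all in lower rows.
  column≤row : ∀ l → col l ≤ row f l
  column≤row l = bound (fun f l) refl
    where
    bound : ∀ c → fun f l ≡ c → toℕ c ≤ row f l
    bound zero    eq = z≤n
    bound (suc j) eq = ℕ.≤-trans
      (subst (_≤ # P?) (cong suc (Fin.toℕ-inject₁ j)) (parking f (inject₁ j)))
      (#-mono-≤ P? (λ μ → below? f μ l) (λ μ → μ) (λ eq → eq)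
        (λ {μ} le → inj₁ (subst (fun f μ Fin.<_) (sym eq) (s≤s (subst (col μ ≤_) (Fin.toℕ-inject₁ j) le)))))
      where
      P? : Decidable (λ μ → fun f μ Fin.≤ inject₁ j)
      P? μ = fun f μ Fin.≤? inject₁ j

  a+column≡row : ∀ l → a f l + col l ≡ row f l
  a+column≡row l = ℕ.m∸n+n≡m (column≤row l)

  -- The areas start from 0 in the bottom row, so they cross the level k on the way up to x.
  crossing : ∀ {k} r x → row f x ≡ r → k < a f x →
             ∃[ μ ] ∃[ ν ] (row f ν ≡ suc (row f μ) × a f μ ≤ k × k < a f ν × row f ν ≤ row f x)
  crossing zero    x eq k<a = contradiction
    (ℕ.<-≤-trans k<a (ℕ.≤-trans (ℕ.m∸n≤m _ (col x)) (ℕ.≤-reflexive eq))) λ ()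
  crossing {k} (suc r) x eq k<a = from-predecessor (k ℕ.<? a f y)
    where
    r<n : r < n
    r<n = ℕ.<-trans (ℕ.n<1+n r) (subst (_< n) eq (row<n x))

    y : Fin n
    y = unrow (fromℕ< r<n)

    row-y : row f y ≡ r
    row-y = trans (row-unrow (fromℕ< r<n)) (Fin.toℕ-fromℕ< r<n)

    x-above-y : row f x ≡ suc (row f y)
    x-above-y = trans eq (cong suc (sym row-y))

    from-predecessor : Dec (k < a f y) → _
    from-predecessor (no  ka) = y , x , x-above-y , ℕ.≮⇒≥ ka , k<a , ℕ.≤-refl
    from-predecessor (yes ka) = let μ , ν , p , q , s , t = crossing r y row-y ka in
      μ , ν , p , q , s , ℕ.≤-trans t (ℕ.≤-trans (ℕ.n≤1+n _) (ℕ.≤-reflexive (sym x-above-y)))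

  -- The area rises by at most one per row, and rises only along a column.
  rise : ∀ {k μ ν} → row f ν ≡ suc (row f μ) → a f μ ≤ k → k < a f ν →
         a f μ ≡ k × a f ν ≡ suc k × fun f μ ≡ fun f ν × μ Fin.< ν
  rise {k} {μ} {ν} next aμ≤k k<aν
    with row-cancel {μ} {ν} (subst (row f μ <_) (sym next) (ℕ.n<1+n _))
  ... | inj₁ lt = contradiction k+col<k+col (ℕ.<-irrefl refl)
    where
    open ℕ.≤-Reasoning
    k+col<k+col : k + col ν < k + col ν
    k+col<k+col = begin-strict
      k + col ν             <⟨ ℕ.+-monoˡ-< (col ν) k<aν ⟩
      a f ν + col ν       ≡⟨ a+column≡row ν ⟩
      row f ν               ≡⟨ next ⟩
      suc (row f μ)         ≡⟨ cong suc (a+column≡row μ) ⟨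
      suc (a f μ + col μ) ≡⟨ ℕ.+-suc (a f μ) (col μ) ⟨
      a f μ + suc (col μ) ≤⟨ ℕ.+-mono-≤ aμ≤k lt ⟩
      k + col ν             ∎
  ... | inj₂ (same , μ<ν) = aμ≡k , trans aν (cong suc aμ≡k) , same , μ<ν
    where
    aν : a f ν ≡ suc (a f μ)
    aν = ℕ.+-cancelʳ-≡ (col ν) (a f ν) (suc (a f μ)) (begin
      a f ν + col ν       ≡⟨ a+column≡row ν ⟩
      row f ν               ≡⟨ next ⟩
      suc (row f μ)         ≡⟨ cong suc (a+column≡row μ) ⟨
      suc (a f μ + col μ) ≡⟨ cong (λ c → suc (a f μ + toℕ c)) same ⟩
      suc (a f μ + col ν) ∎)
      where open ≡-Reasoning
    aμ≡k : a f μ ≡ k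
    aμ≡k = ℕ.≤-antisym aμ≤k (ℕ.≤-pred (subst (k <_) aν k<aν))

  -- Either kind of label is counted for an `x` of level `suc k`: by `counted-adjacent` in the first
  -- case, by `counted-level` in the second.
  Witness : ℕ → Fin n → Set
  Witness k x = (∃[ μ ] (a f μ ≡ k × fun f μ Fin.≤ fun f x × μ Fin.< x))
              ⊎ (∃[ ν ] (a f ν ≡ suc k × fun f ν Fin.< fun f x × x Fin.< ν))

  -- At or below `x` the path climbs from level `k` to `suc k` within one column, from `μ` to `ν`.
  -- If `μ` is smaller than `x`, it is the witness. Otherwise `ν` exceeds `μ` and hence `x`, so it
  -- is neither `x` nor below `x` in the same column; it lies strictly to the left and serves
  -- instead.
  lower-witness : ∀ {k} x → a f x ≡ suc k → (∃[ μ ] a f μ ≡ k) × Witness k x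
  lower-witness {k} x ax with crossing {k} (row f x) x refl (subst (k <_) (sym ax) (ℕ.n<1+n k))
  ... | μ , ν , next , aμ≤k , k<aν , rowν≤rowx with rise next aμ≤k k<aν
  ... | aμ , aν , same , μ<ν = (μ , aμ) , witness (μ Fin.<? x)
    where
    at-or-below : ν ≡ x ⊎ Below f ν x
    at-or-below with ℕ.m≤n⇒m<n∨m≡n rowν≤rowx
    ... | inj₁ lt = inj₂ (row-cancel lt)
    ... | inj₂ eq = inj₁ (row-injective eq)

    witness : Dec (μ Fin.< x) → Witness k x
    witness (yes μ<x) = inj₁ (μ , aμ , subst (λ c → c Fin.≤ fun f x) (sym same) (colν≤ at-or-below) , μ<x)
      where
      colν≤ : ν ≡ x ⊎ Below f ν x → fun f ν Fin.≤ fun f x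
      colν≤ (inj₁ refl)            = ℕ.≤-refl
      colν≤ (inj₂ (inj₁ lt))       = ℕ.<⇒≤ lt
      colν≤ (inj₂ (inj₂ (eq , _))) = ℕ.≤-reflexive (cong toℕ eq)
    witness (no μ≮x) = inj₂ (ν , aν , colν< at-or-below , x<ν)
      where
      x<ν : x Fin.< ν
      x<ν = ℕ.≤-<-trans (ℕ.≮⇒≥ μ≮x) μ<ν
      colν< : ν ≡ x ⊎ Below f ν x → fun f ν Fin.< fun f x
      colν< (inj₁ refl)             = contradiction μ<ν μ≮x
      colν< (inj₂ (inj₁ lt))        = lt
      colν< (inj₂ (inj₂ (_ , ν<x))) = contradiction ν<x (ℕ.<-asym x<ν)

  -- Positions in the reading word.

  Reads : Rel (Fin n) 0ℓ
  Reads μ l = a f μ < a f l ⊎ (a f μ ≡ a f l × fun f μ Fin.< fun f l)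

  private
    module Reading = DecTotalOrder (readingOrder f)

    w-mono : ∀ {i j} → i Fin.≤ j → w f i Reading.≤ w f j
    w-mono {i} {j} i≤j = lookup-mono-≤ Reading.totalOrder
      (SortingAlgorithm.sort-↗ (InsertionSort.insertionSort (readingOrder f)) (allFin n))
      (subst₂ _≤_ (sym (Fin.toℕ-cast _ i)) (sym (Fin.toℕ-cast _ j)) i≤j)

    position-reflects : ∀ {μ l} → position f μ Fin.≤ position f l → μ Reading.≤ l
    position-reflects {μ} {l} le = subst₂ Reading._≤_ (w-position f μ) (w-position f l) (w-mono le)

  position-injective : ∀ {μ l} → position f μ ≡ position f l → μ ≡ l
  position-injective {μ} {l} eq =
    trans (sym (w-position f μ)) (trans (cong (w f) eq) (w-position f l))

  w-injective : ∀ {i j} → w f i ≡ w f j → i ≡ j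
  w-injective {i} {j} eq =
    trans (sym (position-w f i)) (trans (cong (position f) eq) (position-w f j))

  -- A tie in both coordinates is impossible: area plus column is the row, which determines the
  -- label.
  position<⇒Reads : ∀ {μ l} → position f μ Fin.< position f l → Reads μ l
  position<⇒Reads {μ} {l} lt with position-reflects (ℕ.<⇒≤ lt)
  ... | inj₁ (a≤ , a≢) = inj₁ (ℕ.≤∧≢⇒< a≤ a≢)
  ... | inj₂ (a≡ , c≤) = inj₂ (a≡ , ℕ.≤∧≢⇒< c≤ c≢)
    where
    c≢ : col μ ≢ col l
    c≢ c≡ = ℕ.<⇒≢ lt (cong (toℕ ∘ position f) (row-injective {μ} {l}
      (trans (sym (a+column≡row μ)) (trans (cong₂ _+_ a≡ c≡) (a+column≡row l)))))

  Reads⇒position< : ∀ {μ l} → Reads μ l → position f μ Fin.< position f l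
  Reads⇒position< {μ} {l} μl = ℕ.≰⇒> (λ le → refute μl (position-reflects le))
    where
    refute : Reads μ l → ¬ l Reading.≤ μ
    refute (inj₁ lt)        (inj₁ (a≤ , _)) = ℕ.<⇒≱ lt a≤
    refute (inj₁ lt)        (inj₂ (a≡ , _)) = ℕ.<⇒≢ lt (sym a≡)
    refute (inj₂ (a≡ , _))  (inj₁ (_ , a≢)) = a≢ (sym a≡)
    refute (inj₂ (_ , lt))  (inj₂ (_ , c≤)) = ℕ.<⇒≱ lt c≤

  -- The values of `φ` as counts of labels.

  Counted : Rel (Fin n) 0ℓ
  Counted μ l = position f μ Fin.< position f l × ¬ InDinv f μ l

  counted? : Decidable₂ Counted
  counted? μ l = (position f μ Fin.<? position f l) ×-dec ¬? (inDinv? f μ l)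

  -- Counting from zero, the position of `l` is the number of earlier positions; subtracting `d f l`
  -- leaves those without an inversion.
  φ≡#counted : ∀ l → toℕ (φ-fun f l) ≡ # (λ μ → counted? μ l)
  φ≡#counted l = begin
    toℕ (φ-fun f l)                 ≡⟨ Fin.toℕ-fromℕ< _ ⟩
    toℕ (position f l) ∸ d f l      ≡⟨ cong (_∸ d f l) (#<k (position f l)) ⟨
    # before? ∸ d f l               ≡⟨ cong (_∸ d f l) (#-split before? inv?) ⟩
    d f l + # counted-at? ∸ d f l   ≡⟨ ℕ.m+n∸m≡n (d f l) _ ⟩
    -- Positions are exchanged for labels along the mutually inverse `w` and `position`.
    # counted-at?                   ≡⟨ ℕ.≤-antisym
      (#-mono-≤ counted-at? (λ μ → counted? μ l) (w f) w-injective
        (λ {i} (i<p , ¬inv) → subst (Fin._< position f l) (sym (position-w f i)) i<p , ¬inv))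
      (#-mono-≤ (λ μ → counted? μ l) counted-at? (position f) position-injective
        (λ {μ} (p<p , ¬inv) → p<p , ¬inv ∘ subst (λ ν → InDinv f ν l) (w-position f μ))) ⟩
    # (λ μ → counted? μ l)          ∎
    where
    open ≡-Reasoning
    before? : Decidable (λ i → i Fin.< position f l)
    before? i = i Fin.<? position f l
    inv? : Decidable (λ i → InDinv f (w f i) l)
    inv? i = inDinv? f (w f i) l
    counted-at? : Decidable (λ i → i Fin.< position f l × ¬ InDinv f (w f i) l)
    counted-at? i = before? i ×-dec ¬? (inv? i)

  -- An inversion needs areas that differ by at most one.
  counted-lower : ∀ {μ l} → suc (a f μ) < a f l → Counted μ l
  counted-lower lt = Reads⇒position< (inj₁ (ℕ.<-trans (ℕ.n<1+n _) lt)) , λ where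
    (inj₁ (_ , inj₁ (_ , eq))) → ℕ.<⇒≢ (ℕ.<-trans (ℕ.n<1+n _) lt) eq
    (inj₁ (_ , inj₂ (_ , eq))) → ℕ.<⇒≢ lt eq
    (inj₂ (_ , inj₁ (_ , eq))) → ℕ.<⇒≢ (ℕ.<-trans (ℕ.n<1+n _) lt) (sym eq)
    (inj₂ (_ , inj₂ (_ , eq))) → ℕ.<⇒≢ (ℕ.<-trans (ℕ.m<n⇒m<1+n (ℕ.n<1+n _)) (s≤s lt)) (sym eq)

  -- An inversion here would have to be of type (B), with `μ` both smaller than `l` and strictly to
  -- its right; each alternative of the hypothesis excludes this.
  counted-adjacent : ∀ {μ l} → suc (a f μ) ≡ a f l → fun f μ Fin.≤ fun f l ⊎ l Fin.< μ → Counted μ l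
  counted-adjacent {μ} {l} adj away = Reads⇒position< (inj₁ a<) , λ where
      (inj₁ (_ , inj₁ (_ , eq)))     → ℕ.<⇒≢ a< eq
      (inj₁ (μ<l , inj₂ (c< , _)))   → close away μ<l c<
      (inj₂ (_ , inj₁ (_ , eq)))     → ℕ.<⇒≢ a< (sym eq)
      (inj₂ (_ , inj₂ (_ , eq)))     → ℕ.<⇒≢ (ℕ.<-trans a< (ℕ.n<1+n _)) (sym eq)
    where
    a< : a f μ < a f l
    a< = ℕ.≤-reflexive adj
    close : fun f μ Fin.≤ fun f l ⊎ l Fin.< μ → μ Fin.< l → ¬ fun f l Fin.< fun f μ
    close (inj₁ c≤)  _   c< = ℕ.<⇒≱ c< c≤
    close (inj₂ l<μ) μ<l _  = ℕ.<-asym l<μ μ<l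

  -- An inversion on one level has its smaller label on the left.
  counted-level : ∀ {μ l} → a f μ ≡ a f l → fun f μ Fin.< fun f l → l Fin.< μ → Counted μ l
  counted-level {μ} {l} a≡ c< l<μ = Reads⇒position< (inj₂ (a≡ , c<)) , λ where
    (inj₁ (μ<l , _))           → ℕ.<-asym l<μ μ<l
    (inj₂ (_ , inj₁ (c> , _))) → ℕ.<-asym c< c>
    (inj₂ (_ , inj₂ (_ , eq))) → ℕ.<⇒≢ (ℕ.n<1+n _) (sym (trans eq a≡))

  -- Picking order against arrival times.

  -- The order in which the pmaj procedure on φ f picks the labels.
  Picks : Rel (Fin n) 0ℓ
  Picks μ l = a f μ < a f l ⊎ (a f μ ≡ a f l × l Fin.< μ)

  picks? : Decidable₂ Picks
  picks? μ l = (a f μ ℕ.<? a f l) ⊎-dec ((a f μ ℕ.≟ a f l) ×-dec (l Fin.<? μ))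

  module Pick = Rank
    (On.isStrictTotalOrder (λ l → a f l , l)
      (×-isStrictTotalOrder ℕ.<-isStrictTotalOrder (Flip.isStrictTotalOrder Fin.<-isStrictTotalOrder)))
    proj₂ picks?
  open Pick

  -- On a common level, a smaller label further left forms an inversion, so an earlier label without
  -- one is larger.
  counted⇒picks : ∀ {μ l} → Counted μ l → Picks μ l
  counted⇒picks {μ} {l} (p< , ¬inv) with position<⇒Reads p<
  ... | inj₁ a<        = inj₁ a<
  ... | inj₂ (a≡ , c<) = inj₂ (a≡ , ℕ.≤∧≢⇒< (ℕ.≮⇒≥ μ≮l) l≢μ)
    where
    μ≮l : ¬ μ Fin.< l
    μ≮l μ<l = ¬inv (inj₁ (μ<l , inj₁ (c< , a≡)))
    l≢μ : toℕ l ≢ toℕ μ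
    l≢μ eq = ℕ.<⇒≢ p< (cong (toℕ ∘ position f) (sym (Fin.toℕ-injective eq)))

  φ≤rank : ∀ l → toℕ (φ-fun f l) ≤ rank l
  φ≤rank l = subst (_≤ rank l) (sym (φ≡#counted l))
    (#-mono-≤ (λ μ → counted? μ l) (λ μ → picks? μ l) (λ μ → μ) (λ eq → eq) counted⇒picks)

  -- The strictness comes from the further label `e`. The conclusion says that `x` arrives only
  -- after the turn of `y`.
  rank<φ : ∀ {x y e} → (∀ {μ} → Picks μ y → Counted μ x) → Counted e x → ¬ Picks e y →
           rank y < toℕ (φ-fun f x)
  rank<φ {x} {y} all e ¬e = subst (rank y <_) (sym (φ≡#counted x))
    (#-mono-< (λ μ → picks? μ y) (λ μ → counted? μ x) all e ¬e)

  -- When the level rises, `lower-witness` shows that none is skipped, so `p` is the last and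
  -- smallest label of the level just below `y`. A witness of the first kind is at least `p` and
  -- smaller than `y`. One of the second kind would be picked before `y` on the level of `y`,
  -- although everything picked by then has level at most that of `p`.
  rank-suc⇒LevelStep : ∀ {p y} → rank y ≡ suc (rank p) → LevelStep (a f) p y
  rank-suc⇒LevelStep {p} {y} next
    with rank-cancel {p} {y} (subst (rank p <_) (sym next) (ℕ.n<1+n _))
  ... | inj₂ level = inj₁ level
  ... | inj₁ ap<ay = inj₂ (ascend (a f y) refl ap<ay)
    where
    a-before : ∀ {μ} → Picks μ y → a f μ ≤ a f p
    a-before μy with ≺-successor next μy
    ... | inj₁ refl             = ℕ.≤-refl
    ... | inj₂ (inj₁ lt)        = ℕ.<⇒≤ lt
    ... | inj₂ (inj₂ (eq , _))  = ℕ.≤-reflexive eq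

    ascend : ∀ b → a f y ≡ b → a f p < b → suc (a f p) ≡ a f y × p Fin.< y
    ascend (suc k) ay ap≤k with lower-witness y ay
    ... | (μ , aμ) , wit = trans (cong suc ap≡k) (sym ay) , p<y wit
      where
      below : ∀ {μ} → a f μ ≡ k → Picks μ y
      below aμ = inj₁ (subst₂ _<_ (sym aμ) (sym ay) (ℕ.n<1+n k))

      ap≡k : a f p ≡ k
      ap≡k = ℕ.≤-antisym (ℕ.≤-pred ap≤k) (subst (_≤ a f p) aμ (a-before (below aμ)))

      p<y : Witness k y → p Fin.< y
      p<y (inj₁ (μ , aμ , _ , μ<y)) with ≺-successor next (below aμ)
      ... | inj₁ refl            = μ<y
      ... | inj₂ (inj₁ lt)       = contradiction (trans aμ (sym ap≡k)) (ℕ.<⇒≢ lt)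
      ... | inj₂ (inj₂ (_ , lt)) = ℕ.<-trans lt μ<y
      p<y (inj₂ (ν , aν , _ , y<ν)) = contradiction
        (subst₂ _≤_ aν ap≡k (a-before (inj₂ (trans aν (sym ay) , y<ν)))) (ℕ.<-irrefl refl)

  rank-zero⇒a≡0 : ∀ {y} → rank y ≡ 0 → a f y ≡ 0
  rank-zero⇒a≡0 {y} first = base (a f y) refl
    where
    base : ∀ b → a f y ≡ b → a f y ≡ 0
    base zero    ay = ay
    base (suc k) ay with lower-witness y ay
    ... | (μ , aμ) , _ = contradiction
      (subst (rank μ <_) first (rank-mono {μ} {y} (inj₁ (subst₂ _<_ (sym aμ) (sym ay) (ℕ.n<1+n k))))) λ ()

  -- The hypothesis on `μ` puts `x` below all labels already picked on the level of `y`. On adjacent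
  -- levels this keeps them from forming inversions with `x`, and keeps a smaller witness from
  -- having been picked.
  higher-blocked : ∀ {x y} → a f y < a f x → (∀ {μ} → a f μ ≡ a f y → y Fin.< μ → x Fin.< μ) →
                   rank y < toℕ (φ-fun f x)
  higher-blocked {x} {y} ay<ax gap with ℕ.m≤n⇒m<n∨m≡n ay<ax
  ... | inj₁ far = rank<φ {x} {y} (counted-lower ∘ all) (counted-lower far) (≺-irreflexive {y})
    where
    all : ∀ {μ} → Picks μ y → suc (a f μ) < a f x
    all (inj₁ lt)       = ℕ.<-trans (s≤s lt) far
    all (inj₂ (eq , _)) = subst (λ b → suc b < a f x) (sym eq) far
  ... | inj₂ adj = extra (proj₂ (lower-witness x (sym adj)))
    where
    all : ∀ {μ} → Picks μ y → Counted μ x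
    all (inj₁ lt)         = counted-lower (ℕ.<-≤-trans (s≤s lt) (ℕ.≤-reflexive adj))
    all (inj₂ (eq , y<μ)) = counted-adjacent (trans (cong suc eq) adj) (inj₂ (gap eq y<μ))

    extra : Witness (a f y) x → rank y < toℕ (φ-fun f x)
    extra (inj₁ (e , ae , c≤ , e<x)) =
      rank<φ {x} {y} all (counted-adjacent (trans (cong suc ae) adj) (inj₁ c≤)) λ where
        (inj₁ lt)        → ℕ.<⇒≢ lt ae
        (inj₂ (_ , y<e)) → ℕ.<-asym e<x (gap ae y<e)
    extra (inj₂ (e , ae , c< , x<e)) =
      rank<φ {x} {y} all (counted-level (trans ae adj) c< x<e) λ where
        (inj₁ lt)       → ℕ.<-asym lt (ℕ.≤-reflexive (sym ae))
        (inj₂ (eq , _)) → ℕ.<⇒≢ (ℕ.n<1+n _) (trans (sym eq) ae)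

  module _ {p y} (next : rank y ≡ suc (rank p)) (up : suc (a f p) ≡ a f y) where

    private
      before-y : ∀ {μ} → Picks μ y → a f μ < a f p ⊎ (a f μ ≡ a f p × p Fin.≤ μ)
      before-y μy with ≺-successor next μy
      ... | inj₁ refl             = inj₂ (refl , ℕ.≤-refl)
      ... | inj₂ (inj₁ lt)        = inj₁ lt
      ... | inj₂ (inj₂ (eq , lt)) = inj₂ (eq , ℕ.<⇒≤ lt)

    top-of-level : ∀ {μ} → a f μ ≡ a f y → ¬ y Fin.< μ
    top-of-level eq y<μ with before-y (inj₂ (eq , y<μ))
    ... | inj₁ lt       = ℕ.<⇒≢ (ℕ.<-trans lt (ℕ.≤-reflexive up)) eq
    ... | inj₂ (ap , _) = ℕ.<⇒≢ (ℕ.≤-reflexive up) (trans (sym ap) eq)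

    -- Everything picked before `y` is on a lower level, and `p` is the minimum of its level. So a
    -- witness of the first kind, being smaller than `x` and hence than `p`, cannot exist; one of
    -- the second kind shares the level of `y` and is not picked before `y`.
    level-blocked : ∀ {x} → a f x ≡ a f y → x Fin.< p → rank y < toℕ (φ-fun f x)
    level-blocked {x} ax x<p = extra (proj₂ (lower-witness x x-up))
      where
      x-up : a f x ≡ suc (a f p)
      x-up = trans ax (sym up)

      all : ∀ {μ} → Picks μ y → Counted μ x
      all μy with before-y μy
      ... | inj₁ lt         = counted-lower (ℕ.<-≤-trans (s≤s lt) (ℕ.≤-reflexive (sym x-up)))
      ... | inj₂ (eq , p≤μ) =
        counted-adjacent (trans (cong suc eq) (sym x-up)) (inj₂ (ℕ.<-≤-trans x<p p≤μ))

      extra : Witness (a f p) x → rank y < toℕ (φ-fun f x)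
      extra (inj₁ (e , ae , _ , e<x)) with before-y (inj₁ (ℕ.≤-reflexive (trans (cong suc ae) up)))
      ... | inj₁ lt        = contradiction ae (ℕ.<⇒≢ lt)
      ... | inj₂ (_ , p≤e) = contradiction (ℕ.<-trans e<x x<p) (ℕ.≤⇒≯ p≤e)
      extra (inj₂ (e , ae , c< , x<e)) = rank<φ {x} {y} all (counted-level (trans ae (sym x-up)) c< x<e) λ where
        (inj₁ lt)         → ℕ.<⇒≢ lt (trans ae up)
        (inj₂ (eq , y<e)) → top-of-level eq y<e

  -- Within a level, `y` is the largest label left, and higher-level labels below `s` have not
  -- arrived. At a rise of level nothing available is below `s`, so the choice falls back to the
  -- maximum of `B`, which is `y`.
  choose-picks : ∀ {s y} (B : Subset n) → Previous rank s y → y ∈ B →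
                 (∀ {x} → x ∈ B → toℕ (φ-fun f x) ≤ rank y × (x ≡ y ⊎ Picks y x)) →
                 choose s B ≡ just y
  choose-picks {s} {y} B prev y∈B eligible = by-step prev
    where
    below-s : toℕ y < s → (∀ {μ} → a f μ ≡ a f y → y Fin.< μ → s ≤ toℕ μ) → choose s B ≡ just y
    below-s y<s gap = choose-below s B y∈B y<s bound
      where
      bound : ∀ {x} → x ∈ B → toℕ x < s → x Fin.≤ y
      bound {x} x∈B x<s with eligible x∈B
      ... | _  , inj₁ refl             = ℕ.≤-refl
      ... | _  , inj₂ (inj₂ (_ , x<y)) = ℕ.<⇒≤ x<y
      ... | φ≤ , inj₂ (inj₁ ay<ax)     = contradiction φ≤
        (ℕ.<⇒≱ (higher-blocked {x} {y} ay<ax (λ eq y<μ → ℕ.<-≤-trans x<s (gap eq y<μ))))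

    by-step : Previous rank s y → choose s B ≡ just y
    -- The initial `s` is `n`, above every label, and no larger label of the same level can precede
    -- rank zero.
    by-step (inj₁ (refl , first)) = below-s (Fin.toℕ<n y)
      (λ {μ} eq y<μ → contradiction (subst (rank μ <_) first (rank-mono {μ} {y} (inj₂ (eq , y<μ)))) λ ())
    by-step (inj₂ (p , refl , next)) with rank-suc⇒LevelStep {p} {y} next
    ... | inj₁ (ap≡ay , y<p) = below-s y<p gap
      where
      gap : ∀ {μ} → a f μ ≡ a f y → y Fin.< μ → p Fin.≤ μ
      gap eq y<μ with ≺-successor next (inj₂ (eq , y<μ))
      ... | inj₁ refl            = ℕ.≤-refl
      ... | inj₂ (inj₁ lt)       = contradiction (trans eq (sym ap≡ay)) (ℕ.<⇒≢ lt)
      ... | inj₂ (inj₂ (_ , lt)) = ℕ.<⇒≤ lt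
    ... | inj₂ (up , p<y) = choose-wrap (toℕ p) B y∈B
        (λ x∈B → proj₁ (bounds x∈B)) (λ x∈B → proj₂ (bounds x∈B))
      where
      bounds : ∀ {x} → x ∈ B → ¬ x Fin.< p × x Fin.≤ y
      bounds {x} x∈B with eligible x∈B
      ... | _  , inj₁ refl              = ℕ.<-asym p<y , ℕ.≤-refl
      ... | φ≤ , inj₂ (inj₂ (eq , x<y)) =
        (λ x<p → ℕ.<⇒≱ (level-blocked {p} {y} next up {x} (sym eq) x<p) φ≤) , ℕ.<⇒≤ x<y
      ... | φ≤ , inj₂ (inj₁ ay<ax)      = contradiction φ≤
        -- Here `y` is the maximum of its level, so the hypothesis on `μ` holds vacuously.
        (ℕ.<⇒≱ (higher-blocked {x} {y} ay<ax
          (λ eq y<μ → contradiction y<μ (top-of-level {p} {y} next up eq))))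

  -- The picked word of `φ f` and its major index.

  σpmaj-φ : σpmaj (φ f) ≡ tabulate unrank
  σpmaj-φ = σpmaj-by-rank (φ f) rank unrank rank-unrank rank-injective φ≤rank
    λ {s} {y} B prev y∈B eligible → choose-picks B prev y∈B λ {x} x∈B →
      let φ≤ , r≤ = eligible x∈B in φ≤ , rank-cancel-≤ {y} {x} r≤

  pmaj-φ : pmaj (φ f) ≡ area f
  pmaj-φ = begin
    pmaj (φ f)                         ≡⟨ cong (λ v → maj (reverse v)) σpmaj-φ ⟩
    maj (reverse (tabulate unrank))    ≡⟨ maj-reverse-tabulate (a f) unrank
      (λ {i} eq → rank-zero⇒a≡0 (trans (rank-unrank i) eq))
      (λ {i} {j} eq → rank-suc⇒LevelStep
        (trans (rank-unrank j) (trans eq (cong suc (sym (rank-unrank i)))))) ⟩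
    sum (map (a f) (tabulate unrank))  ≡⟨ sum-↭ (map⁺ (a f) (tabulate-↭ unrank unrank-injective)) ⟩
    area f                             ∎
    where open ≡-Reasoning

theorem7p1 : (n : ℕ) → 1 ≤ n → (f : PF n) → pmaj (φ f) ≡ area f
theorem7p1 n _ f = pmaj-φ f
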